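{- Let $n\in\mathbb{Z}^+$, $v\in\mathbb{N}$ and $z\in\mathbb{Z}\setminus\{0,-1\}$. Define $c_0=\tilde c_0=1$ and, for $v\ge 1$, recursively $$c_v=\frac{1}{z}\sum_{j=1}^{v}e_j^{(2v-1)}c_{v-j},\qquad \tilde c_v=-\frac{1}{z+1}\sum_{j=1}^{v}e_j^{(2v-1)}\tilde c_{v-j}.$$ Then $c_v\in z^{ -v}\mathbb{Z}[z]$ and $\tilde c_v\in (z+1)^{ -v}\mathbb{Z}[z]$. Moreover, if $\gcd(n,2z)=1$ then $$\sum_{k=0}^{n-1}(2k+1)^{2v}D_k(z)\equiv c_v\sum_{k=0}^{n-1}D_k(z)\pmod n,$$ and if $\gcd(n,2(z+1))=1$ then $$\sum_{k=0}^{n-1}(-1)^k(2k+1)^{2v}D_k(z)\equiv \tilde c_v\sum_{k=0}^{n-1}(-1)^kD_k(z)\pmod n.$$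
   Context: The Delannoy polynomials are $D_n(z)=\sum_{k=0}^{n}\binom{n}{k}\binom{n+k}{k}z^k$ for $n\in\mathbb{N}$. For $s\in\mathbb{N}$ and $j=1,2,\dots,\lfloor (s+1)/2\rfloor$, set $e_j^{(s)}=\binom{s}{2j}2^{2j-1}+\binom{s}{2j-1}2^{2j-2}\in\mathbb{Z}$. Congruences involving rational numbers are understood in the usual way: for a rational $a/b$ with $\gcd(b,n)=1$, $a/b\equiv c\pmod n$ means $a\equiv bc\pmod n$ (here the denominators of $c_v$, resp. $\tilde c_v$, evaluated at the integer $z$, divide a power of $z$, resp. $z+1$, hence are coprime to $n$ under the stated hypotheses). -}

module Defs where

open import Data.Fin.Base using (Fin; toℕ)
open import Data.Integer.Base as ℤ using (ℤ; +_; 0ℤ; 1ℤ)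
open import Data.Integer.Divisibility as ℤ using (_∣_)
import Data.Integer.Properties as ℤ
open import Data.List.Base using (List; foldr)
open import Data.Nat.Base as ℕ using (ℕ; zero; suc)
open import Data.Nat.Combinatorics using (_C_)
open import Data.Nat.Coprimality as Coprime using (Coprime; 1-coprimeTo)
open import Data.Product.Base using (_×_)
open import Data.Rational.Base as ℚ using (ℚ; mkℚ; 0ℚ; 1ℚ; ↥_; ↧_; ↧ₙ_)
import Data.Rational.Properties as ℚ
open import Data.Vec.Base using (Vec; []; _∷_; head; lookup)
open import Function.Base using (_∘_)
open import Relation.Binary.PropositionalEquality using (_≡_; refl)

import Algebra.Definitions.RawMonoid (ℤ.+-0-rawMonoid) as ℤSum
import Algebra.Definitions.RawMonoid (ℚ.+-0-rawMonoid) as ℚSum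
import Algebra.Definitions.RawSemiring (ℚ.+-*-rawSemiring) as ℚPow

-- ∑ n (λ k → f k) is f 0 + … + f (n - 1).
∑ : ℕ → (ℕ → ℤ) → ℤ
∑ n f = ℤSum.sum {n} (f ∘ toℕ)

infix 5 ∑
syntax ∑ n (λ k → t) = ∑[ k < n ] t

infixr 8 _^ℚ_
_^ℚ_ : ℚ → ℕ → ℚ
_^ℚ_ = ℚPow._^_

fromℤ : ℤ → ℚ
fromℤ i = mkℚ i 0 (Coprime.sym (1-coprimeTo ℤ.∣ i ∣))

recip : (i : ℤ) .{{_ : ℤ.NonZero i}} → ℚ
recip i = ℚ.1/ fromℤ i

D : ℕ → ℤ → ℤ
D n z = ∑[ k < suc n ] (+ (n C k) ℤ.* + ((n ℕ.+ k) C k) ℤ.* z ℤ.^ k)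

-- Meaningful for j ≥ 1 only: truncated subtraction agrees with
-- subtraction in that range.
e : ℕ → ℕ → ℤ
e s j = + ( (s C (2 ℕ.* j)) ℕ.* 2 ℕ.^ (2 ℕ.* j ℕ.∸ 1)
        ℕ.+ (s C (2 ℕ.* j ℕ.∸ 1)) ℕ.* 2 ℕ.^ (2 ℕ.* j ℕ.∸ 2))

-- For a sequence with a₀ = 1 and aᵥ = r · ∑_{j=1}^{v} e_j^{(2v-1)} aᵥ₋ⱼ
-- when v ≥ 1, the vector (aᵥ , aᵥ₋₁ , … , a₀).  The summation index i
-- stands for j - 1, so that position i of the previous vector holds aᵥ₋ⱼ.
history : ℚ → (v : ℕ) → Vec ℚ (suc v)
history r zero    = 1ℚ ∷ []
history r (suc u) =
  r ℚ.* ℚSum.sum (λ (i : Fin (suc u)) →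
          fromℤ (e (2 ℕ.* suc u ℕ.∸ 1) (suc (toℕ i))) ℚ.* lookup (history r u) i)
  ∷ history r u

recSeq : ℚ → ℕ → ℚ
recSeq r v = head (history r v)

lookup-history : ∀ r v (i : Fin (suc v)) →
                 lookup (history r v) i ≡ recSeq r (v ℕ.∸ toℕ i)
lookup-history r zero    Fin.zero    = refl
lookup-history r (suc v) Fin.zero    = refl
lookup-history r (suc v) (Fin.suc i) = lookup-history r v i

c : ℕ → (z : ℤ) .{{_ : ℤ.NonZero z}} → ℚ
c v z = recSeq (recip z) v

c̃ : ℕ → (z : ℤ) .{{_ : ℤ.NonZero (z ℤ.+ 1ℤ)}} → ℚ
c̃ v z = recSeq (ℚ.- recip (z ℤ.+ 1ℤ)) v

-- Integer polynomials, as lists of coefficients starting with the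
-- constant term.
ℤ[z] : Set
ℤ[z] = List ℤ

eval : ℤ[z] → ℤ → ℤ
eval P z = foldr (λ a b → a ℤ.+ z ℤ.* b) 0ℤ P

-- The integer x is congruent to the rational q = a / b modulo n, meaning
-- gcd(b , n) = 1 and a ≡ b x modulo n.  Taking a / b in lowest terms loses
-- nothing: if some representation has denominator prime to n, so does the
-- reduced one, and the two congruences are equivalent.
infix 4 _≡_[mod_]
_≡_[mod_] : ℤ → ℚ → ℕ → Set
x ≡ q [mod n ] = Coprime (↧ₙ q) n × (+ n) ∣ (↥ q ℤ.- ↧ q ℤ.* x)

{-# OPTIONS --safe #-}

-- Write S_v = ∑_{k<n} (2k+1)^{2v} E_k, where E_k = D_k(z), w = z, or
-- E_k = (-1)^k D_k(z), w = -(z+1).  In both cases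
-- (k+1) E_{k+1} + k E_{k-1} = (2w+1)(2k+1) E_k.  Multiplying this recurrence
-- by (2k+1)^s with s = 2v-1 and shifting the sums over k < n, the boundary
-- terms are multiples of n, so ∑_k E_k g(2k+1) ≡ 0 with
-- 2 g(x) = (x+1)(x+2)^s + (x-1)(x-2)^s - 2(2w+1) x^{s+1}.  The binomial theorem
-- gives g(x) = 2 ∑_j e_j^{(s)} x^{2(v-j)} - 2w x^{2v}, and cancelling 2 yields
-- w S_v ≡ ∑_j e_j^{(s)} S_{v-j}, which is the recursion of c_v (or c̃_v) with r = 1/w.
module Submission where

open import Defs

open import Algebra.Bundles using (CommutativeRing)
import Algebra.Properties.CommutativeSemigroup as CommutativeSemigroupProperties
import Algebra.Properties.Semiring.Sum as SemiringSum
open import Data.Fin.Base using (Fin; toℕ)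
open import Data.Fin.Properties using (toℕ≤pred[n])
open import Data.Integer.Base
  using (ℤ; +_; 0ℤ; 1ℤ; -1ℤ; NonZero; _+_; _*_; _^_; _-_; -_; ∣_∣)
import Data.Integer.Coprimality as ℤ
open import Data.Integer.Divisibility.Signed
open import Data.Integer.GCD using (gcd)
open import Data.Integer.Properties
open import Data.Integer.Tactic.RingSolver using (solve-∀)
open import Data.List.Base using ([]; _∷_; map)
open import Data.Nat.Base as ℕ using (ℕ; zero; suc; s≤s; z≤n; _<_; _∸_)
open import Data.Nat.Combinatorics using (_C_; nCk+nC[k+1]≡[n+1]C[k+1]; k>n⇒nCk≡0)
open import Data.Nat.Coprimality as Coprime using (Coprime)
import Data.Nat.Divisibility as ℕ
import Data.Nat.Properties as ℕ
open import Data.Product.Base using (∃-syntax; _×_; _,_)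
open import Data.Rational.Base as ℚ using (ℚ; 1ℚ; mkℚ; ↧_; ↧ₙ_)
import Data.Rational.Properties as ℚ
open import Data.Rational.Unnormalised.Base using (*≡*)
import Data.Rational.Unnormalised.Properties as ℚᵘ
open import Data.Vec.Base using (lookup)
open import Function.Base using (_∘_)
open import Relation.Binary.PropositionalEquality

open ≡-Reasoning
open CommutativeSemigroupProperties (CommutativeRing.*-commutativeSemigroup ℚ.+-*-commutativeRing)
  using (x∙yz≈y∙xz; xy∙z≈xz∙y) renaming (interchange to *-interchange)
module ℚSum = SemiringSum (CommutativeRing.semiring ℚ.+-*-commutativeRing)

-- Behind the common treatment of the two cases is Legendre symmetry: D_k(z) = P_k(2z+1), the
-- recurrence is Bonnet's, and P_k(-x) = (-1)^k P_k(x) gives (-1)^k D_k(z) = D_k(-(z+1)). Only the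
-- resulting sign change in the recurrence is used. The exponent s must be odd: then x -> -x
-- exchanges (x+1)(x+2)^s and (x-1)(x-2)^s, so their sum contains only even powers of x and the
-- relation stays among the sums S_v. The obstacle is that c_v is a fraction while the relation
-- between the S_v holds modulo n in ℤ. The integers N_v = w^v c_v bridge the gap. They satisfy a
-- recursion without division, which shows that N_v is a polynomial in w, and the same recursion
-- gives N_v S_0 ≡ w^v S_v modulo n. Rational numbers in lowest terms enter only at the end, where
-- w^v is cancelled.

-- Since l - r vanishes, the hypothesis l ≡ r may be added with any cofactor c. Nested uses collect
-- several hypotheses, and what remains is a pure ring identity for the solver.
linear-combination : ∀ {a b l r : ℤ} c → l ≡ r → a ≡ b + c * (l - r) → a ≡ b
linear-combination {b = b} {r = r} c refl eq = trans eq
  (trans (cong (λ t → b + c * t) (+-inverseʳ r)) (trans (cong (_+_ b) (*-zeroʳ c)) (+-identityʳ b)))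

-- Finite sums of integers.

-- Unlike ∑, whose summand is a function on Fin n, this sum lets Agda infer f.
sum : ℕ → (ℕ → ℤ) → ℤ
sum zero    f = 0ℤ
sum (suc n) f = f 0 + sum n (f ∘ suc)

∑≡sum : ∀ n f → ∑ n f ≡ sum n f
∑≡sum zero    f = refl
∑≡sum (suc n) f = cong (_+_ (f 0)) (∑≡sum n (f ∘ suc))

sum-cong-< : ∀ n {f g} → (∀ k → k < n → f k ≡ g k) → sum n f ≡ sum n g
sum-cong-< zero    eq = refl
sum-cong-< (suc n) eq = cong₂ _+_ (eq 0 (s≤s z≤n)) (sum-cong-< n (λ k k<n → eq (suc k) (s≤s k<n)))

sum-cong : ∀ n {f g} → (∀ k → f k ≡ g k) → sum n f ≡ sum n g
sum-cong n eq = sum-cong-< n (λ k _ → eq k)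

sum-last : ∀ n f → sum (suc n) f ≡ sum n f + f n
sum-last zero    f = +-comm (f 0) 0ℤ
sum-last (suc n) f = begin
  f 0 + sum (suc n) (f ∘ suc)         ≡⟨ cong (_+_ (f 0)) (sum-last n (f ∘ suc)) ⟩
  f 0 + (sum n (f ∘ suc) + f (suc n)) ≡⟨ +-assoc (f 0) _ _ ⟨
  f 0 + sum n (f ∘ suc) + f (suc n)   ∎

sum-last-zero : ∀ n f → f n ≡ 0ℤ → sum (suc n) f ≡ sum n f
sum-last-zero n f fn≡0 = trans (sum-last n f) (trans (cong (_+_ (sum n f)) fn≡0) (+-identityʳ _))

sum-zero : ∀ n → sum n (λ _ → 0ℤ) ≡ 0ℤ
sum-zero zero    = refl
sum-zero (suc n) = trans (+-identityˡ _) (sum-zero n)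

sum-+ : ∀ n f g → sum n (λ k → f k + g k) ≡ sum n f + sum n g
sum-+ zero    f g = refl
sum-+ (suc n) f g = begin
  f 0 + g 0 + sum n (λ k → f (suc k) + g (suc k))       ≡⟨ cong (_+_ (f 0 + g 0)) (sum-+ n (f ∘ suc) (g ∘ suc)) ⟩
  f 0 + g 0 + (sum n (f ∘ suc) + sum n (g ∘ suc))       ≡⟨ interchange (f 0) (g 0) _ _ ⟩
  f 0 + sum n (f ∘ suc) + (g 0 + sum n (g ∘ suc))       ∎
  where
  interchange : ∀ a b c d → a + b + (c + d) ≡ a + c + (b + d)
  interchange = solve-∀

sum-*ˡ : ∀ n a f → a * sum n f ≡ sum n (λ k → a * f k)
sum-*ˡ zero    a f = *-zeroʳ a
sum-*ˡ (suc n) a f = trans (*-distribˡ-+ a (f 0) _) (cong (_+_ (a * f 0)) (sum-*ˡ n a (f ∘ suc)))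

sum-*ʳ : ∀ n f a → sum n f * a ≡ sum n (λ k → f k * a)
sum-*ʳ n f a = trans (*-comm (sum n f) a) (trans (sum-*ˡ n a f) (sum-cong n (λ k → *-comm a (f k))))

sum-linear : ∀ n a b f g → a * sum n f + b * sum n g ≡ sum n (λ k → a * f k + b * g k)
sum-linear n a b f g = trans (cong₂ _+_ (sum-*ˡ n a f) (sum-*ˡ n b g))
  (sym (sum-+ n (λ k → a * f k) (λ k → b * g k)))

sum-comm : ∀ m n (f : ℕ → ℕ → ℤ) →
           sum m (λ i → sum n (f i)) ≡ sum n (λ j → sum m (λ i → f i j))
sum-comm zero    n f = sym (sum-zero n)
sum-comm (suc m) n f = begin
  sum n (f 0) + sum m (λ i → sum n (f (suc i)))           ≡⟨ cong (_+_ (sum n (f 0))) (sum-comm m n (f ∘ suc)) ⟩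
  sum n (f 0) + sum n (λ j → sum m (λ i → f (suc i) j))   ≡⟨ sum-+ n (f 0) _ ⟨
  sum n (λ j → f 0 j + sum m (λ i → f (suc i) j))         ∎

sum-even-odd : ∀ n f → sum (2 ℕ.* n) f ≡ sum n (λ k → f (2 ℕ.* k) + f (suc (2 ℕ.* k)))
sum-even-odd zero    f = refl
sum-even-odd (suc n) f = begin
  sum (2 ℕ.* suc n) f                          ≡⟨ cong (λ t → sum t f) (ℕ.*-suc 2 n) ⟩
  f 0 + (f 1 + sum (2 ℕ.* n) (f ∘ suc ∘ suc))  ≡⟨ +-assoc (f 0) (f 1) _ ⟨
  f 0 + f 1 + sum (2 ℕ.* n) (f ∘ suc ∘ suc)    ≡⟨ cong (_+_ (f 0 + f 1)) (sum-even-odd n (f ∘ suc ∘ suc)) ⟩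
  f 0 + f 1 + sum n (λ k → f (suc (suc (2 ℕ.* k))) + f (suc (suc (suc (2 ℕ.* k)))))
    ≡⟨ cong (_+_ (f 0 + f 1)) (sum-cong n (λ k → cong (λ t → f t + f (suc t)) (ℕ.*-suc 2 k))) ⟨
  f 0 + f 1 + sum n (λ k → f (2 ℕ.* suc k) + f (suc (2 ℕ.* suc k))) ∎

-- Binomial coefficients as integers.

binom : ℕ → ℕ → ℤ
binom n k = + (n C k)

binom-zero : ∀ {n k} → n < k → binom n k ≡ 0ℤ
binom-zero n<k = cong +_ (k>n⇒nCk≡0 n<k)

pascal : ∀ n k → binom n k + binom n (suc k) ≡ binom (suc n) (suc k)
pascal n k = cong +_ (nCk+nC[k+1]≡[n+1]C[k+1] n k)

-- Induction on n through Pascal's rule. The other two ratios of neighbouring binomial coefficients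
-- below are linear consequences of this one and `pascal`; over ℤ they hold for k beyond n as well.
absorption : ∀ n k → (1ℤ + + k) * binom (suc n) (suc k) ≡ (1ℤ + + n) * binom n k
absorption zero    zero    = refl
absorption zero    (suc k) = trans (cong ((+ 2 + + k) *_) (binom-zero {1} {suc (suc k)} (s≤s (s≤s z≤n))))
                               (trans (*-zeroʳ (+ 2 + + k))
                                 (sym (cong (1ℤ *_) (binom-zero {0} {suc k} (s≤s z≤n)))))
absorption (suc n) zero    = begin
  1ℤ * binom (suc (suc n)) 1
    ≡⟨ cong (1ℤ *_) (pascal (suc n) 0) ⟨
  1ℤ * (1ℤ + binom (suc n) 1)
    ≡⟨ linear-combination 1ℤ (absorption n zero) (lemma (+ n) (binom (suc n) 1)) ⟩
  (+ 2 + + n) * 1ℤ ∎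
  where
  lemma : ∀ n b → 1ℤ * (1ℤ + b) ≡ (+ 2 + n) * 1ℤ + 1ℤ * (1ℤ * b - (1ℤ + n) * 1ℤ)
  lemma = solve-∀
absorption (suc n) (suc k) = begin
  (+ 2 + + k) * binom (suc (suc n)) (suc (suc k))                 ≡⟨ cong ((+ 2 + + k) *_) (pascal (suc n) (suc k)) ⟨
  (+ 2 + + k) * (binom (suc n) (suc k) + binom (suc n) (suc (suc k)))
    ≡⟨ linear-combination 1ℤ (absorption n k) (linear-combination 1ℤ (absorption n (suc k))
         (linear-combination (1ℤ + + n) (pascal n k)
         (lemma (+ n) (+ k) (binom n k) (binom n (suc k)) (binom (suc n) (suc k)) (binom (suc n) (suc (suc k)))))) ⟩
  (+ 2 + + n) * binom (suc n) (suc k)                             ∎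
  where
  lemma : ∀ n k b₀ b₁ c₁ c₂ → (+ 2 + k) * (c₁ + c₂) ≡
    (+ 2 + n) * c₁ + 1ℤ * ((1ℤ + k) * c₁ - (1ℤ + n) * b₀) + 1ℤ * ((+ 2 + k) * c₂ - (1ℤ + n) * b₁)
      + (1ℤ + n) * (b₀ + b₁ - c₁)
  lemma = solve-∀

binom-suc-lower : ∀ n k → (1ℤ + + k) * binom n (suc k) ≡ (+ n - + k) * binom n k
binom-suc-lower n k = linear-combination 1ℤ (absorption n k) (linear-combination (1ℤ + + k) (pascal n k)
  (lemma (+ n) (+ k) (binom n k) (binom n (suc k)) (binom (suc n) (suc k))))
  where
  lemma : ∀ n k b₀ b₁ c₁ → (1ℤ + k) * b₁ ≡
    (n - k) * b₀ + 1ℤ * ((1ℤ + k) * c₁ - (1ℤ + n) * b₀) + (1ℤ + k) * (b₀ + b₁ - c₁)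
  lemma = solve-∀

binom-suc-upper : ∀ n k → (1ℤ + + n - + k) * binom (suc n) k ≡ (1ℤ + + n) * binom n k
binom-suc-upper n zero    = cong (_* 1ℤ) (+-identityʳ (1ℤ + + n))
binom-suc-upper n (suc k) = linear-combination (- 1ℤ) (absorption n k) (linear-combination (- (1ℤ + + n)) (pascal n k)
  (lemma (+ n) (+ k) (binom n k) (binom n (suc k)) (binom (suc n) (suc k))))
  where
  lemma : ∀ n k b₀ b₁ c₁ → (1ℤ + n - (1ℤ + k)) * c₁ ≡
    (1ℤ + n) * b₁ + - 1ℤ * ((1ℤ + k) * c₁ - (1ℤ + n) * b₀) + - (1ℤ + n) * (b₀ + b₁ - c₁)
  lemma = solve-∀

-- Coefficients of the Delannoy polynomials and their three-term recurrence.

delannoyCoeff : ℕ → ℕ → ℤ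
delannoyCoeff n k = binom n k * binom (n ℕ.+ k) k

-- For k ≤ n the coefficient is (n+k)! / ((n-k)! k!²), so neighbouring coefficients have a rational
-- ratio in n and k. This lemma and the next two are such ratios with denominators cleared, which
-- keeps them valid where coefficients vanish.
delannoyCoeff-suc-suc : ∀ n k → (1ℤ + + k) * (1ℤ + + k) * delannoyCoeff (suc n) (suc k) ≡
                        (+ 2 + + n + + k) * (1ℤ + + n + + k) * delannoyCoeff n k
delannoyCoeff-suc-suc n k rewrite ℕ.+-suc n k =
  linear-combination ((1ℤ + + k) * binom (suc (suc (n ℕ.+ k))) (suc k)) (absorption n k)
  (linear-combination ((1ℤ + + n) * binom n k) (absorption (suc (n ℕ.+ k)) k)
  (linear-combination ((+ 2 + + n + + k) * binom n k) (binom-suc-upper (n ℕ.+ k) k)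
  (lemma (+ n) (+ k) (binom n k) (binom (suc n) (suc k)) (binom (n ℕ.+ k) k)
    (binom (suc (n ℕ.+ k)) k) (binom (suc (suc (n ℕ.+ k))) (suc k)))))
  where
  lemma : ∀ n k a a′ p q q′ → (1ℤ + k) * (1ℤ + k) * (a′ * q′) ≡
    (+ 2 + n + k) * (1ℤ + n + k) * (a * p)
      + (1ℤ + k) * q′ * ((1ℤ + k) * a′ - (1ℤ + n) * a)
      + (1ℤ + n) * a * ((1ℤ + k) * q′ - (+ 2 + (n + k)) * q)
      + (+ 2 + n + k) * a * ((1ℤ + (n + k) - k) * q - (1ℤ + (n + k)) * p)
  lemma = solve-∀

delannoyCoeff-suc-upper : ∀ n k → (1ℤ + + n - + k) * delannoyCoeff (suc n) k ≡
                          (1ℤ + + n + + k) * delannoyCoeff n k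
delannoyCoeff-suc-upper n k =
  linear-combination (binom (suc (n ℕ.+ k)) k) (binom-suc-upper n k)
  (linear-combination (binom n k) (binom-suc-upper (n ℕ.+ k) k)
  (lemma (+ n) (+ k) (binom n k) (binom (suc n) k) (binom (n ℕ.+ k) k) (binom (suc (n ℕ.+ k)) k)))
  where
  lemma : ∀ n k a a′ p q → (1ℤ + n - k) * (a′ * q) ≡
    (1ℤ + n + k) * (a * p) + q * ((1ℤ + n - k) * a′ - (1ℤ + n) * a)
      + a * ((1ℤ + (n + k) - k) * q - (1ℤ + (n + k)) * p)
  lemma = solve-∀

delannoyCoeff-suc-lower : ∀ n k → (1ℤ + + k) * (1ℤ + + k) * delannoyCoeff n (suc k) ≡
                          (+ n - + k) * (1ℤ + + n + + k) * delannoyCoeff n k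
delannoyCoeff-suc-lower n k rewrite ℕ.+-suc n k =
  linear-combination ((1ℤ + + k) * binom (suc (n ℕ.+ k)) (suc k)) (binom-suc-lower n k)
  (linear-combination ((+ n - + k) * binom n k) (absorption (n ℕ.+ k) k)
  (lemma (+ n) (+ k) (binom n k) (binom n (suc k)) (binom (n ℕ.+ k) k) (binom (suc (n ℕ.+ k)) (suc k))))
  where
  lemma : ∀ n k a a′ p q → (1ℤ + k) * (1ℤ + k) * (a′ * q) ≡
    (n - k) * (1ℤ + n + k) * (a * p) + (1ℤ + k) * q * ((1ℤ + k) * a′ - (n - k) * a)
      + (n - k) * a * ((1ℤ + k) * q - (1ℤ + (n + k)) * p)
  lemma = solve-∀

-- All four coefficients are expressed by delannoyCoeff (suc n) k, with common
-- denominator (k+1)².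
delannoyCoeff-recurrence : ∀ n k →
  (+ 2 + + n) * delannoyCoeff (2 ℕ.+ n) (suc k) + (1ℤ + + n) * delannoyCoeff n (suc k) ≡
  (+ 3 + + 2 * + n) * (delannoyCoeff (suc n) (suc k) + + 2 * delannoyCoeff (suc n) k)
delannoyCoeff-recurrence n k = *-cancelˡ-≡ ((1ℤ + + k) * (1ℤ + + k)) _ _
  (linear-combination (+ 2 + + n) (delannoyCoeff-suc-suc (suc n) k)
  (linear-combination (1ℤ + + n) (delannoyCoeff-suc-lower n k)
  (linear-combination (- (+ 3 + + 2 * + n)) (delannoyCoeff-suc-lower (suc n) k)
  (linear-combination (- ((1ℤ + + n) * (+ n - + k))) (delannoyCoeff-suc-upper n k)
  (lemma (+ n) (+ k) (delannoyCoeff n k) (delannoyCoeff n (suc k)) (delannoyCoeff (suc n) k)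
    (delannoyCoeff (suc n) (suc k)) (delannoyCoeff (2 ℕ.+ n) (suc k)))))))
  where
  lemma : ∀ n k d₀ d₀′ d₁ d₁′ d₂′ →
    (1ℤ + k) * (1ℤ + k) * ((+ 2 + n) * d₂′ + (1ℤ + n) * d₀′) ≡
    (1ℤ + k) * (1ℤ + k) * ((+ 3 + + 2 * n) * (d₁′ + + 2 * d₁))
      + (+ 2 + n) * ((1ℤ + k) * (1ℤ + k) * d₂′ - (+ 2 + (1ℤ + n) + k) * (1ℤ + (1ℤ + n) + k) * d₁)
      + (1ℤ + n) * ((1ℤ + k) * (1ℤ + k) * d₀′ - (n - k) * (1ℤ + n + k) * d₀)
      + - (+ 3 + + 2 * n) * ((1ℤ + k) * (1ℤ + k) * d₁′ - (1ℤ + n - k) * (1ℤ + (1ℤ + n) + k) * d₁)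
      + - ((1ℤ + n) * (n - k)) * ((1ℤ + n - k) * d₁ - (1ℤ + n + k) * d₀)
  lemma = solve-∀

delannoyCoeff-zero : ∀ {n k} → n < k → delannoyCoeff n k ≡ 0ℤ
delannoyCoeff-zero {n} {k} n<k = trans (cong (_* binom (n ℕ.+ k) k) (binom-zero n<k)) (*-zeroˡ (binom (n ℕ.+ k) k))

delannoySum : ℕ → ℕ → ℤ → ℤ
delannoySum N n z = sum N (λ k → delannoyCoeff n k * z ^ k)

-- Padding with j vanishing terms brings polynomials of different degrees to a common length, so
-- that they can be compared termwise.
D≡delannoySum : ∀ j n z → D n z ≡ delannoySum (suc (j ℕ.+ n)) n z
D≡delannoySum zero    n z = ∑≡sum (suc n) (λ k → delannoyCoeff n k * z ^ k)
D≡delannoySum (suc j) n z = trans (D≡delannoySum j n z)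
  (sym (sum-last-zero k (λ k → delannoyCoeff n k * z ^ k)
    (trans (cong (_* z ^ k) (delannoyCoeff-zero (s≤s (ℕ.m≤n+m n j)))) (*-zeroˡ (z ^ k)))))
  where
  k = suc (j ℕ.+ n)

-- Comparison of coefficients: the constant terms give (n+2) + (n+1) = 2n+3, and z^(k+1) is
-- `delannoyCoeff-recurrence`, where the factor 2z shifts the coefficient at k up by one.
D-recurrence : ∀ z n → (+ 2 + + n) * D (2 ℕ.+ n) z + (1ℤ + + n) * D n z ≡
               (+ 2 * z + 1ℤ) * ((+ 3 + + 2 * + n) * D (1 ℕ.+ n) z)
D-recurrence z n = begin
  (+ 2 + + n) * D (2 ℕ.+ n) z + (1ℤ + + n) * D n z
    ≡⟨ cong₂ (λ s t → (+ 2 + + n) * s + (1ℤ + + n) * t) (D≡delannoySum 0 (2 ℕ.+ n) z) (D≡delannoySum 2 n z) ⟩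
  (+ 2 + + n) * (1ℤ + sum N (d₂ ∘ suc)) + (1ℤ + + n) * (1ℤ + sum N (d₀ ∘ suc))
    ≡⟨ linear-combination 1ℤ coefficients
         (expand (+ n) z (sum N (d₀ ∘ suc)) (sum N (d₁ ∘ suc)) (sum N d₁) (sum N (d₂ ∘ suc))) ⟩
  (+ 3 + + 2 * + n) * (1ℤ + sum N (d₁ ∘ suc)) + + 2 * z * ((+ 3 + + 2 * + n) * sum N d₁)
    ≡⟨ cong₂ (λ s t → (+ 3 + + 2 * + n) * s + + 2 * z * ((+ 3 + + 2 * + n) * t))
         (D≡delannoySum 1 (1 ℕ.+ n) z) (D≡delannoySum 0 (1 ℕ.+ n) z) ⟨
  (+ 3 + + 2 * + n) * D (1 ℕ.+ n) z + + 2 * z * ((+ 3 + + 2 * + n) * D (1 ℕ.+ n) z)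
    ≡⟨ collect z ((+ 3 + + 2 * + n) * D (1 ℕ.+ n) z) ⟩
  (+ 2 * z + 1ℤ) * ((+ 3 + + 2 * + n) * D (1 ℕ.+ n) z) ∎
  where
  N = 2 ℕ.+ n
  d₀ d₁ d₂ : ℕ → ℤ
  d₀ k = delannoyCoeff n k * z ^ k
  d₁ k = delannoyCoeff (1 ℕ.+ n) k * z ^ k
  d₂ k = delannoyCoeff (2 ℕ.+ n) k * z ^ k

  term : ∀ k → (+ 2 + + n) * d₂ (suc k) + (1ℤ + + n) * d₀ (suc k) ≡
         (+ 3 + + 2 * + n) * d₁ (suc k) + + 2 * z * (+ 3 + + 2 * + n) * d₁ k
  term k = linear-combination (z ^ suc k) (delannoyCoeff-recurrence n k)
    (lemma (+ n) z (z ^ k) (delannoyCoeff (2 ℕ.+ n) (suc k)) (delannoyCoeff n (suc k))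
      (delannoyCoeff (suc n) (suc k)) (delannoyCoeff (suc n) k))
    where
    lemma : ∀ n z zᵏ a b c d → (+ 2 + n) * (a * (z * zᵏ)) + (1ℤ + n) * (b * (z * zᵏ)) ≡
      (+ 3 + + 2 * n) * (c * (z * zᵏ)) + + 2 * z * (+ 3 + + 2 * n) * (d * zᵏ)
        + z * zᵏ * ((+ 2 + n) * a + (1ℤ + n) * b - (+ 3 + + 2 * n) * (c + + 2 * d))
    lemma = solve-∀

  coefficients : (+ 2 + + n) * sum N (d₂ ∘ suc) + (1ℤ + + n) * sum N (d₀ ∘ suc) ≡
                 (+ 3 + + 2 * + n) * sum N (d₁ ∘ suc) + + 2 * z * (+ 3 + + 2 * + n) * sum N d₁
  coefficients = begin
    (+ 2 + + n) * sum N (d₂ ∘ suc) + (1ℤ + + n) * sum N (d₀ ∘ suc)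
      ≡⟨ sum-linear N (+ 2 + + n) (1ℤ + + n) (d₂ ∘ suc) (d₀ ∘ suc) ⟩
    sum N (λ k → (+ 2 + + n) * d₂ (suc k) + (1ℤ + + n) * d₀ (suc k))
      ≡⟨ sum-cong N term ⟩
    sum N (λ k → (+ 3 + + 2 * + n) * d₁ (suc k) + + 2 * z * (+ 3 + + 2 * + n) * d₁ k)
      ≡⟨ sum-linear N (+ 3 + + 2 * + n) (+ 2 * z * (+ 3 + + 2 * + n)) (d₁ ∘ suc) d₁ ⟨
    (+ 3 + + 2 * + n) * sum N (d₁ ∘ suc) + + 2 * z * (+ 3 + + 2 * + n) * sum N d₁ ∎

  expand : ∀ n z s₀ s₁ t₁ s₂ → (+ 2 + n) * (1ℤ + s₂) + (1ℤ + n) * (1ℤ + s₀) ≡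
    (+ 3 + + 2 * n) * (1ℤ + s₁) + + 2 * z * ((+ 3 + + 2 * n) * t₁)
      + 1ℤ * ((+ 2 + n) * s₂ + (1ℤ + n) * s₀ - ((+ 3 + + 2 * n) * s₁ + + 2 * z * (+ 3 + + 2 * n) * t₁))
  expand = solve-∀

  collect : ∀ z d → d + + 2 * z * d ≡ (+ 2 * z + 1ℤ) * d
  collect = solve-∀

-- Summing the recurrence against a weight.

-- Centred at n + 1, which avoids a predecessor. The instance centred at 0, where the lower
-- neighbour has coefficient 0, is carried separately as `E 1 ≡ m * E 0`.
DelannoyRecurrence : ℤ → (ℕ → ℤ) → Set
DelannoyRecurrence m E =
  ∀ n → (+ 2 + + n) * E (2 ℕ.+ n) + (1ℤ + + n) * E n ≡ m * ((+ 3 + + 2 * + n) * E (1 ℕ.+ n))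

-- p k stands for the weight at index k - 1.
telescope : ∀ m E (p : ℕ → ℤ) → E 1 ≡ m * E 0 → DelannoyRecurrence m E → ∀ n →
  sum (suc n) (λ k → E k * ((1ℤ + + k) * p (2 ℕ.+ k) + + k * p k - m * (1ℤ + + 2 * + k) * p (1 ℕ.+ k))) ≡
  (1ℤ + + n) * (p (2 ℕ.+ n) * E n - p (1 ℕ.+ n) * E (1 ℕ.+ n))
telescope m E p E₁ rec zero    = linear-combination (p 1) E₁ (lemma m (E 0) (E 1) (p 0) (p 1) (p 2))
  where
  lemma : ∀ m e₀ e₁ p₀ p₁ p₂ → e₀ * ((1ℤ + 0ℤ) * p₂ + 0ℤ * p₀ - m * (1ℤ + + 2 * 0ℤ) * p₁) + 0ℤ ≡
    (1ℤ + 0ℤ) * (p₂ * e₀ - p₁ * e₁) + p₁ * (e₁ - m * e₀)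
  lemma = solve-∀
telescope m E p E₁ rec (suc n) = trans (sum-last (suc n) g) (trans (cong (_+ g (suc n)) (telescope m E p E₁ rec n))
  -- The recurrence centred at n + 1 is multiplied by the weight at that index; this moves the
  -- boundary term up by one.
  (linear-combination (p (2 ℕ.+ n)) (rec n)
    (lemma m (+ n) (E n) (E (1 ℕ.+ n)) (E (2 ℕ.+ n)) (p (1 ℕ.+ n)) (p (2 ℕ.+ n)) (p (3 ℕ.+ n)))))
  where
  g : ℕ → ℤ
  g k = E k * ((1ℤ + + k) * p (2 ℕ.+ k) + + k * p k - m * (1ℤ + + 2 * + k) * p (1 ℕ.+ k))

  lemma : ∀ m n e₀ e₁ e₂ p₁ p₂ p₃ →
    (1ℤ + n) * (p₂ * e₀ - p₁ * e₁) + e₁ * ((+ 2 + n) * p₃ + (1ℤ + n) * p₁ - m * (1ℤ + + 2 * (1ℤ + n)) * p₂) ≡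
    (+ 2 + n) * (p₃ * e₁ - p₂ * e₂) + p₂ * ((+ 2 + n) * e₂ + (1ℤ + n) * e₀ - m * ((+ 3 + + 2 * n) * e₁))
  lemma = solve-∀

-- The binomial theorem and the numbers e_j.

binomial-theorem : ∀ x y s → (x + y) ^ s ≡ sum (suc s) (λ k → binom s k * (y ^ k * x ^ (s ∸ k)))
binomial-theorem x y zero    = refl
binomial-theorem x y (suc s) = begin
  (x + y) * (x + y) ^ s
    ≡⟨ cong ((x + y) *_) (binomial-theorem x y s) ⟩
  (x + y) * sum (suc s) t
    ≡⟨ *-distribʳ-+ (sum (suc s) t) x y ⟩
  x * sum (suc s) t + y * sum (suc s) t
    ≡⟨ cong (λ a → a + y * sum (suc s) t) x-part ⟩
  1ℤ * (1ℤ * x ^ suc s) + sum (suc s) (λ k → binom s (suc k) * (y ^ suc k * x ^ (s ∸ k))) + y * sum (suc s) t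
    ≡⟨ +-assoc (1ℤ * (1ℤ * x ^ suc s)) _ _ ⟩
  1ℤ * (1ℤ * x ^ suc s) + (sum (suc s) (λ k → binom s (suc k) * (y ^ suc k * x ^ (s ∸ k))) + y * sum (suc s) t)
    ≡⟨ cong (_+_ (1ℤ * (1ℤ * x ^ suc s))) y-part ⟩
  1ℤ * (1ℤ * x ^ suc s) + sum (suc s) (λ k → binom (suc s) (suc k) * (y ^ suc k * x ^ (s ∸ k))) ∎
  where
  t u : ℕ → ℤ
  t k = binom s k * (y ^ k * x ^ (s ∸ k))
  u k = binom s k * (y ^ k * x ^ (suc s ∸ k))

  move : ∀ x b c d → x * (b * (c * d)) ≡ b * (c * (x * d))
  move = solve-∀

  x-part : x * sum (suc s) t ≡ sum (suc (suc s)) u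
  x-part = begin
    x * sum (suc s) t             ≡⟨ sum-*ˡ (suc s) x t ⟩
    sum (suc s) (λ k → x * t k)
      ≡⟨ sum-cong-< (suc s) (λ { k (s≤s k≤s) → trans (move x (binom s k) (y ^ k) (x ^ (s ∸ k)))
           (cong (λ j → binom s k * (y ^ k * x ^ j)) (sym (ℕ.+-∸-assoc 1 k≤s))) }) ⟩
    sum (suc s) u                 ≡⟨ sum-last-zero (suc s) u (trans (cong (_* (y ^ suc s * x ^ (suc s ∸ suc s)))
                                       (binom-zero (ℕ.n<1+n s))) (*-zeroˡ (y ^ suc s * x ^ (suc s ∸ suc s)))) ⟨
    sum (suc (suc s)) u           ∎

  collect : ∀ y a b c d → b * (y * c * d) + y * (a * (c * d)) ≡ (a + b) * (y * c * d)
  collect = solve-∀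

  y-part : sum (suc s) (λ k → binom s (suc k) * (y ^ suc k * x ^ (s ∸ k))) + y * sum (suc s) t ≡
           sum (suc s) (λ k → binom (suc s) (suc k) * (y ^ suc k * x ^ (s ∸ k)))
  y-part = begin
    sum (suc s) (u ∘ suc) + y * sum (suc s) t
      ≡⟨ cong (_+_ (sum (suc s) (u ∘ suc))) (sum-*ˡ (suc s) y t) ⟩
    sum (suc s) (u ∘ suc) + sum (suc s) (λ k → y * t k)
      ≡⟨ sum-+ (suc s) (u ∘ suc) (λ k → y * t k) ⟨
    sum (suc s) (λ k → u (suc k) + y * t k)
      ≡⟨ sum-cong (suc s) (λ k → trans (collect y (binom s k) (binom s (suc k)) (y ^ k) (x ^ (s ∸ k)))
           (cong (_* (y ^ suc k * x ^ (s ∸ k))) (pascal s k))) ⟩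
    sum (suc s) (λ k → binom (suc s) (suc k) * (y ^ suc k * x ^ (s ∸ k))) ∎

pos-^ : ∀ m n → + (m ℕ.^ n) ≡ (+ m) ^ n
pos-^ m zero    = refl
pos-^ m (suc n) = trans (pos-* m (m ℕ.^ n)) (cong (+ m *_) (pos-^ m n))

^-double : ∀ i n → i ^ (2 ℕ.* n) ≡ (i * i) ^ n
^-double i n = trans (sym (^-*-assoc i 2 n)) (cong (λ j → (i * j) ^ n) (*-identityʳ i))

e-suc : ∀ s j → e s (suc j) ≡ + 2 * (+ 4) ^ j * binom s (2 ℕ.+ 2 ℕ.* j) + (+ 4) ^ j * binom s (1 ℕ.+ 2 ℕ.* j)
e-suc s j = trans
  (cong (λ t → + ((s C t) ℕ.* 2 ℕ.^ (t ∸ 1) ℕ.+ (s C (t ∸ 1)) ℕ.* 2 ℕ.^ (t ∸ 2))) (ℕ.*-suc 2 j)) (cong₂ _+_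
  (trans (move (s C (2 ℕ.+ 2 ℕ.* j)) (1 ℕ.+ 2 ℕ.* j)) (cong (λ t → + 2 * t * binom s (2 ℕ.+ 2 ℕ.* j)) (^-double (+ 2) j)))
  (trans (move (s C (1 ℕ.+ 2 ℕ.* j)) (2 ℕ.* j)) (cong (_* binom s (1 ℕ.+ 2 ℕ.* j)) (^-double (+ 2) j))))
  where
  move : ∀ m n → + (m ℕ.* 2 ℕ.^ n) ≡ (+ 2) ^ n * + m
  move m n = begin
    + (m ℕ.* 2 ℕ.^ n)      ≡⟨ pos-* m (2 ℕ.^ n) ⟩
    + m * + (2 ℕ.^ n)      ≡⟨ cong (+ m *_) (pos-^ 2 n) ⟩
    + m * (+ 2) ^ n        ≡⟨ *-comm (+ m) ((+ 2) ^ n) ⟩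
    (+ 2) ^ n * + m        ∎

-- In the expansion, a term with even k gets the factor (x+1) + (x-1) = 2x, one with odd k gets
-- (x+1) - (x-1) = 2. The even term 2j+2 and the odd term 2j+1 thus carry the same power of x, and
-- together they form 4 e_{j+1}; the even term 0 is left over as the leading term.
binomial-e : ∀ x u → let s = suc (2 ℕ.* u) in
  (x + 1ℤ) * (x + + 2) ^ s + (x - 1ℤ) * (x - + 2) ^ s ≡
  + 2 * x ^ (2 ℕ.* suc u) + + 4 * sum (suc u) (λ j → e s (suc j) * x ^ (2 ℕ.* (u ∸ j)))
binomial-e x u = begin
  (x + 1ℤ) * (x + + 2) ^ s + (x - 1ℤ) * (x - + 2) ^ s
    ≡⟨ cong₂ (λ a b → (x + 1ℤ) * a + (x - 1ℤ) * b) (binomial-theorem x (+ 2) s) (binomial-theorem x (- + 2) s) ⟩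
  (x + 1ℤ) * sum (suc s) (term (+ 2)) + (x - 1ℤ) * sum (suc s) (term (- + 2))
    ≡⟨ sum-linear (suc s) (x + 1ℤ) (x - 1ℤ) (term (+ 2)) (term (- + 2)) ⟩
  sum (suc s) both
    ≡⟨ cong (λ n → sum n both) (ℕ.*-suc 2 u) ⟨
  sum (2 ℕ.* suc u) both
    ≡⟨ sum-even-odd (suc u) both ⟩
  sum (suc u) (λ j → both (2 ℕ.* j) + both (suc (2 ℕ.* j)))
    ≡⟨ sum-cong-< (suc u) (λ { j (s≤s j≤u) → cong₂ _+_ (both-even j j≤u) (both-odd j) }) ⟩
  sum (suc u) (λ j → even j + odd j)
    ≡⟨ sum-+ (suc u) even odd ⟩
  sum (suc u) even + sum (suc u) odd
    -- Appending the even term with index 2u+2 > s, which is zero, provides a partner for the last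
    -- odd term.
    ≡⟨ cong (_+ sum (suc u) odd) (sum-last-zero (suc u) even even-last) ⟨
  even 0 + sum (suc u) (even ∘ suc) + sum (suc u) odd
    ≡⟨ +-assoc (even 0) (sum (suc u) (even ∘ suc)) (sum (suc u) odd) ⟩
  even 0 + (sum (suc u) (even ∘ suc) + sum (suc u) odd)
    ≡⟨ cong (_+_ (even 0)) (sum-+ (suc u) (even ∘ suc) odd) ⟨
  even 0 + sum (suc u) (λ j → even (suc j) + odd j)
    ≡⟨ cong₂ _+_ (first (x ^ (2 ℕ.* suc u))) (sum-cong (suc u) pair) ⟩
  + 2 * x ^ (2 ℕ.* suc u) + sum (suc u) (λ j → + 4 * (e s (suc j) * x ^ (2 ℕ.* (u ∸ j))))
    ≡⟨ cong (_+_ (+ 2 * x ^ (2 ℕ.* suc u))) (sum-*ˡ (suc u) (+ 4) (λ j → e s (suc j) * x ^ (2 ℕ.* (u ∸ j)))) ⟨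
  + 2 * x ^ (2 ℕ.* suc u) + + 4 * sum (suc u) (λ j → e s (suc j) * x ^ (2 ℕ.* (u ∸ j))) ∎
  where
  s = suc (2 ℕ.* u)

  term : ℤ → ℕ → ℤ
  term y k = binom s k * (y ^ k * x ^ (s ∸ k))

  both even odd : ℕ → ℤ
  both k = (x + 1ℤ) * term (+ 2) k + (x - 1ℤ) * term (- + 2) k
  even j = + 2 * binom s (2 ℕ.* j) * ((+ 4) ^ j * x ^ (2 ℕ.* (suc u ∸ j)))
  odd  j = + 4 * binom s (suc (2 ℕ.* j)) * ((+ 4) ^ j * x ^ (2 ℕ.* (u ∸ j)))

  exponent-odd : ∀ j → s ∸ suc (2 ℕ.* j) ≡ 2 ℕ.* (u ∸ j)
  exponent-odd j = sym (ℕ.*-distribˡ-∸ 2 u j)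

  exponent-even : ∀ j → j ℕ.≤ u → suc (s ∸ 2 ℕ.* j) ≡ 2 ℕ.* (suc u ∸ j)
  exponent-even j j≤u = begin
    suc (s ∸ 2 ℕ.* j)               ≡⟨ cong suc (ℕ.+-∸-assoc 1 (ℕ.*-monoʳ-≤ 2 j≤u)) ⟩
    2 ℕ.+ (2 ℕ.* u ∸ 2 ℕ.* j)       ≡⟨ cong (λ t → 2 ℕ.+ t) (ℕ.*-distribˡ-∸ 2 u j) ⟨
    2 ℕ.+ 2 ℕ.* (u ∸ j)             ≡⟨ ℕ.*-suc 2 (u ∸ j) ⟨
    2 ℕ.* suc (u ∸ j)               ≡⟨ cong (2 ℕ.*_) (ℕ.+-∸-assoc 1 j≤u) ⟨
    2 ℕ.* (suc u ∸ j)               ∎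

  both-even : ∀ j → j ℕ.≤ u → both (2 ℕ.* j) ≡ even j
  both-even j j≤u = begin
    both (2 ℕ.* j)
      ≡⟨ cong₂ shape (^-double (+ 2) j) (^-double (- + 2) j) ⟩
    shape ((+ 4) ^ j) ((+ 4) ^ j)
      ≡⟨ lemma x b ((+ 4) ^ j) y ⟩
    + 2 * b * ((+ 4) ^ j * x ^ suc (s ∸ 2 ℕ.* j))
      ≡⟨ cong (λ t → + 2 * b * ((+ 4) ^ j * x ^ t)) (exponent-even j j≤u) ⟩
    even j ∎
    where
    b = binom s (2 ℕ.* j)
    y = x ^ (s ∸ 2 ℕ.* j)
    shape : ℤ → ℤ → ℤ
    shape p q = (x + 1ℤ) * (b * (p * y)) + (x - 1ℤ) * (b * (q * y))

    lemma : ∀ x b c d → (x + 1ℤ) * (b * (c * d)) + (x - 1ℤ) * (b * (c * d)) ≡ + 2 * b * (c * (x * d))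
    lemma = solve-∀

  both-odd : ∀ j → both (suc (2 ℕ.* j)) ≡ odd j
  both-odd j = begin
    both (suc (2 ℕ.* j))
      ≡⟨ cong₂ shape (^-double (+ 2) j) (^-double (- + 2) j) ⟩
    shape ((+ 4) ^ j) ((+ 4) ^ j)
      ≡⟨ lemma x b ((+ 4) ^ j) y ⟩
    + 4 * b * ((+ 4) ^ j * y)
      ≡⟨ cong (λ t → + 4 * b * ((+ 4) ^ j * x ^ t)) (exponent-odd j) ⟩
    odd j ∎
    where
    b = binom s (suc (2 ℕ.* j))
    y = x ^ (s ∸ suc (2 ℕ.* j))
    shape : ℤ → ℤ → ℤ
    shape p q = (x + 1ℤ) * (b * (+ 2 * p * y)) + (x - 1ℤ) * (b * (- + 2 * q * y))

    lemma : ∀ x b c d →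
      (x + 1ℤ) * (b * (+ 2 * c * d)) + (x - 1ℤ) * (b * (- + 2 * c * d)) ≡ + 4 * b * (c * d)
    lemma = solve-∀

  even-last : even (suc u) ≡ 0ℤ
  even-last = trans (cong (λ t → + 2 * t * d) (binom-zero (ℕ.≤-reflexive (sym (ℕ.*-suc 2 u))))) (*-zeroˡ d)
    where d = (+ 4) ^ suc u * x ^ (2 ℕ.* (suc u ∸ suc u))

  first : ∀ t → + 2 * 1ℤ * (1ℤ * t) ≡ + 2 * t
  first = solve-∀

  pair : ∀ j → even (suc j) + odd j ≡ + 4 * (e s (suc j) * x ^ (2 ℕ.* (u ∸ j)))
  pair j = begin
    even (suc j) + odd j
      ≡⟨ cong (λ t → + 2 * binom s t * ((+ 4) ^ suc j * x ^ (2 ℕ.* (u ∸ j))) + odd j) (ℕ.*-suc 2 j) ⟩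
    + 2 * binom s (2 ℕ.+ 2 ℕ.* j) * ((+ 4) ^ suc j * x ^ (2 ℕ.* (u ∸ j))) + odd j
      ≡⟨ lemma (binom s (2 ℕ.+ 2 ℕ.* j)) (binom s (1 ℕ.+ 2 ℕ.* j)) ((+ 4) ^ j) (x ^ (2 ℕ.* (u ∸ j))) ⟩
    + 4 * ((+ 2 * (+ 4) ^ j * binom s (2 ℕ.+ 2 ℕ.* j) + (+ 4) ^ j * binom s (1 ℕ.+ 2 ℕ.* j)) * x ^ (2 ℕ.* (u ∸ j)))
      ≡⟨ cong (λ t → + 4 * (t * x ^ (2 ℕ.* (u ∸ j)))) (e-suc s j) ⟨
    + 4 * (e s (suc j) * x ^ (2 ℕ.* (u ∸ j))) ∎
    where
    lemma : ∀ a b c d → + 2 * a * (+ 4 * c * d) + + 4 * b * (c * d) ≡ + 4 * ((+ 2 * c * a + c * b) * d)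
    lemma = solve-∀

-- Integer numerators of c_v.

-- Strong induction in the shape of the recursion for c_v. No bound on j is carried: for j > u
-- truncated subtraction gives P 0.
course-of-values : ∀ {ℓ} (P : ℕ → Set ℓ) → P 0 → (∀ u → (∀ j → P (u ∸ j)) → P (suc u)) → ∀ v → P v
course-of-values P P₀ step v = below v 0
  where
  below : ∀ v j → P (v ∸ j)
  below zero    zero    = P₀
  below zero    (suc j) = P₀
  below (suc u) zero    = step u (below u)
  below (suc u) (suc j) = below u j

odd-index : ∀ u → 2 ℕ.* suc u ∸ 1 ≡ suc (2 ℕ.* u)
odd-index u = cong (_∸ 1) (ℕ.*-suc 2 u)

-- Clearing denominators in c_v = r ∑_j e_j c_{v-j}, where r = 1/w, gives
-- integers w^v c_v = ∑_j e_j w^{j-1} (w^{v-j} c_{v-j}).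
numeratorHistory : ℤ → ℕ → ℕ → ℤ
numeratorHistory w zero    j       = 1ℤ
numeratorHistory w (suc u) zero    =
  sum (suc u) (λ j → e (suc (2 ℕ.* u)) (suc j) * (w ^ j * numeratorHistory w u j))
numeratorHistory w (suc u) (suc j) = numeratorHistory w u j

numerator : ℤ → ℕ → ℤ
numerator w v = numeratorHistory w v 0

numeratorHistory≡numerator : ∀ w u j → numeratorHistory w u j ≡ numerator w (u ∸ j)
numeratorHistory≡numerator w zero    zero    = refl
numeratorHistory≡numerator w zero    (suc j) = refl
numeratorHistory≡numerator w (suc u) zero    = refl
numeratorHistory≡numerator w (suc u) (suc j) = numeratorHistory≡numerator w u j

-- The second argument of `numeratorHistory` counts steps back, which makes its recursion
-- structural; this is the intended recursion on values.
numerator-suc : ∀ w u → numerator w (suc u) ≡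
                sum (suc u) (λ j → e (suc (2 ℕ.* u)) (suc j) * (w ^ j * numerator w (u ∸ j)))
numerator-suc w u = sum-cong (suc u) (λ j →
  cong (λ t → e (suc (2 ℕ.* u)) (suc j) * (w ^ j * t)) (numeratorHistory≡numerator w u j))

-- Polynomial dependence on z.

-- P is chosen before z. Closure under ring operations then yields the witnesses without writing any
-- of them out.
IsPolynomial : (ℤ → ℤ) → Set
IsPolynomial f = ∃[ P ] (∀ z → eval P z ≡ f z)

const-polynomial : ∀ a → IsPolynomial (λ _ → a)
const-polynomial a = a ∷ [] , λ z → trans (cong (_+_ a) (*-zeroʳ z)) (+-identityʳ a)

id-polynomial : IsPolynomial (λ z → z)
id-polynomial = 0ℤ ∷ 1ℤ ∷ [] , eval-id
  where
  eval-id : ∀ z → 0ℤ + z * (1ℤ + z * 0ℤ) ≡ z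
  eval-id = solve-∀

infixl 6 _⊕_
_⊕_ : ℤ[z] → ℤ[z] → ℤ[z]
[]      ⊕ Q       = Q
(a ∷ P) ⊕ []      = a ∷ P
(a ∷ P) ⊕ (b ∷ Q) = a + b ∷ P ⊕ Q

eval-⊕ : ∀ P Q z → eval (P ⊕ Q) z ≡ eval P z + eval Q z
eval-⊕ []      Q       z = sym (+-identityˡ (eval Q z))
eval-⊕ (a ∷ P) []      z = sym (+-identityʳ (eval (a ∷ P) z))
eval-⊕ (a ∷ P) (b ∷ Q) z = trans (cong (λ t → a + b + z * t) (eval-⊕ P Q z)) (lemma a b z (eval P z) (eval Q z))
  where
  lemma : ∀ a b z p q → a + b + z * (p + q) ≡ a + z * p + (b + z * q)
  lemma = solve-∀

eval-map-* : ∀ a P z → eval (map (a *_) P) z ≡ a * eval P z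
eval-map-* a []      z = sym (*-zeroʳ a)
eval-map-* a (b ∷ P) z = trans (cong (λ t → a * b + z * t) (eval-map-* a P z)) (lemma a b z (eval P z))
  where
  lemma : ∀ a b z p → a * b + z * (a * p) ≡ a * (b + z * p)
  lemma = solve-∀

infixl 7 _⊗_
_⊗_ : ℤ[z] → ℤ[z] → ℤ[z]
[]      ⊗ Q = []
(a ∷ P) ⊗ Q = map (a *_) Q ⊕ (0ℤ ∷ P ⊗ Q)

eval-⊗ : ∀ P Q z → eval (P ⊗ Q) z ≡ eval P z * eval Q z
eval-⊗ []      Q z = sym (*-zeroˡ (eval Q z))
eval-⊗ (a ∷ P) Q z = begin
  eval (map (a *_) Q ⊕ (0ℤ ∷ P ⊗ Q)) z              ≡⟨ eval-⊕ (map (a *_) Q) (0ℤ ∷ P ⊗ Q) z ⟩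
  eval (map (a *_) Q) z + (0ℤ + z * eval (P ⊗ Q) z) ≡⟨ cong₂ (λ s t → s + (0ℤ + z * t)) (eval-map-* a Q z) (eval-⊗ P Q z) ⟩
  a * eval Q z + (0ℤ + z * (eval P z * eval Q z))   ≡⟨ lemma a z (eval P z) (eval Q z) ⟩
  (a + z * eval P z) * eval Q z                     ∎
  where
  lemma : ∀ a z p q → a * q + (0ℤ + z * (p * q)) ≡ (a + z * p) * q
  lemma = solve-∀

+-polynomial : ∀ {f g} → IsPolynomial f → IsPolynomial g → IsPolynomial (λ z → f z + g z)
+-polynomial (P , p) (Q , q) = P ⊕ Q , λ z → trans (eval-⊕ P Q z) (cong₂ _+_ (p z) (q z))

*-polynomial : ∀ {f g} → IsPolynomial f → IsPolynomial g → IsPolynomial (λ z → f z * g z)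
*-polynomial (P , p) (Q , q) = P ⊗ Q , λ z → trans (eval-⊗ P Q z) (cong₂ _*_ (p z) (q z))

^-polynomial : ∀ {f} → IsPolynomial f → ∀ n → IsPolynomial (λ z → f z ^ n)
^-polynomial p zero    = const-polynomial 1ℤ
^-polynomial p (suc n) = *-polynomial p (^-polynomial p n)

sum-polynomial : ∀ n {f : ℕ → ℤ → ℤ} → (∀ k → IsPolynomial (f k)) → IsPolynomial (λ z → sum n (λ k → f k z))
sum-polynomial zero    p = const-polynomial 0ℤ
sum-polynomial (suc n) p = +-polynomial (p 0) (sum-polynomial n (p ∘ suc))

-- Allowing w to be any polynomial in z lets one induction serve both w = z and w = -(z+1).
numerator-polynomial : ∀ {w} → IsPolynomial w → ∀ v → IsPolynomial (λ z → numerator (w z) v)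
numerator-polynomial {w} W = course-of-values _ (const-polynomial 1ℤ) (λ u IH →
  let Q , q = sum-polynomial (suc u) (λ j →
                *-polynomial (const-polynomial (e (suc (2 ℕ.* u)) (suc j))) (*-polynomial (^-polynomial W j) (IH j)))
  in Q , λ z → trans (q z) (sym (numerator-suc (w z) u)))

-- Integers inside ℚ and the form r^v times an integer.

fromℤ-+ : ∀ i j → fromℤ (i + j) ≡ fromℤ i ℚ.+ fromℤ j
fromℤ-+ i j = ℚ.toℚᵘ-injective (ℚᵘ.≃-trans (*≡* (lemma i j)) (ℚᵘ.≃-sym (ℚ.toℚᵘ-homo-+ (fromℤ i) (fromℤ j))))
  where
  lemma : ∀ i j → (i + j) * 1ℤ ≡ (i * 1ℤ + j * 1ℤ) * 1ℤ
  lemma = solve-∀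

fromℤ-* : ∀ i j → fromℤ (i * j) ≡ fromℤ i ℚ.* fromℤ j
fromℤ-* i j = ℚ.toℚᵘ-injective (ℚᵘ.≃-trans (*≡* refl) (ℚᵘ.≃-sym (ℚ.toℚᵘ-homo-* (fromℤ i) (fromℤ j))))

fromℤ-neg : ∀ i → fromℤ (- i) ≡ ℚ.- fromℤ i
fromℤ-neg i = ℚ.toℚᵘ-injective (ℚᵘ.≃-trans (*≡* refl) (ℚᵘ.≃-sym (ℚ.toℚᵘ-homo‿- (fromℤ i))))

fromℤ-sum : ∀ n f → ℚSum.sum {n} (λ i → fromℤ (f (toℕ i))) ≡ fromℤ (sum n f)
fromℤ-sum zero    f = refl
fromℤ-sum (suc n) f = trans (cong (fromℤ (f 0) ℚ.+_) (fromℤ-sum n (f ∘ suc))) (sym (fromℤ-+ (f 0) (sum n (f ∘ suc))))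

^ℚ-∸ : ∀ {r w} → r ℚ.* fromℤ w ≡ 1ℚ → ∀ {u j} → j ℕ.≤ u → r ^ℚ (u ∸ j) ≡ r ^ℚ u ℚ.* fromℤ (w ^ j)
^ℚ-∸ {r} {w} rw≡1 {u} z≤n = sym (ℚ.*-identityʳ (r ^ℚ u))
^ℚ-∸ {r} {w} rw≡1 {suc u} {suc j} (s≤s j≤u) = begin
  r ^ℚ (u ∸ j)                                          ≡⟨ ^ℚ-∸ rw≡1 j≤u ⟩
  r ^ℚ u ℚ.* fromℤ (w ^ j)                              ≡⟨ ℚ.*-identityˡ _ ⟨
  1ℚ ℚ.* (r ^ℚ u ℚ.* fromℤ (w ^ j))                     ≡⟨ cong (ℚ._* (r ^ℚ u ℚ.* fromℤ (w ^ j))) rw≡1 ⟨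
  r ℚ.* fromℤ w ℚ.* (r ^ℚ u ℚ.* fromℤ (w ^ j))          ≡⟨ *-interchange r (fromℤ w) (r ^ℚ u) (fromℤ (w ^ j)) ⟩
  r ^ℚ suc u ℚ.* (fromℤ w ℚ.* fromℤ (w ^ j))            ≡⟨ cong (r ^ℚ suc u ℚ.*_) (fromℤ-* w (w ^ j)) ⟨
  r ^ℚ suc u ℚ.* fromℤ (w ^ suc j)                      ∎

recSeq≡numerator : ∀ {r w} → r ℚ.* fromℤ w ≡ 1ℚ → ∀ v → recSeq r v ≡ r ^ℚ v ℚ.* fromℤ (numerator w v)
recSeq≡numerator {r} {w} rw≡1 = course-of-values _ refl step
  where
  step : ∀ u → (∀ j → recSeq r (u ∸ j) ≡ r ^ℚ (u ∸ j) ℚ.* fromℤ (numerator w (u ∸ j))) →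
         recSeq r (suc u) ≡ r ^ℚ suc u ℚ.* fromℤ (numerator w (suc u))
  step u IH = begin
    r ℚ.* ℚSum.sum (λ (i : Fin (suc u)) → fromℤ (e (2 ℕ.* suc u ∸ 1) (suc (toℕ i))) ℚ.* lookup (history r u) i)
      ≡⟨ cong (r ℚ.*_) (ℚSum.sum-cong-≗ {suc u} term) ⟩
    r ℚ.* ℚSum.sum (λ (i : Fin (suc u)) → r ^ℚ u ℚ.* fromℤ (t (toℕ i)))
      ≡⟨ cong (r ℚ.*_) (ℚSum.*-distribˡ-sum (r ^ℚ u) (λ (i : Fin (suc u)) → fromℤ (t (toℕ i)))) ⟨
    r ℚ.* (r ^ℚ u ℚ.* ℚSum.sum (λ (i : Fin (suc u)) → fromℤ (t (toℕ i))))
      ≡⟨ cong (λ x → r ℚ.* (r ^ℚ u ℚ.* x)) (fromℤ-sum (suc u) t) ⟩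
    r ℚ.* (r ^ℚ u ℚ.* fromℤ (sum (suc u) t))
      ≡⟨ ℚ.*-assoc r (r ^ℚ u) _ ⟨
    r ^ℚ suc u ℚ.* fromℤ (sum (suc u) t)
      ≡⟨ cong (λ x → r ^ℚ suc u ℚ.* fromℤ x) (numerator-suc w u) ⟨
    r ^ℚ suc u ℚ.* fromℤ (numerator w (suc u)) ∎
    where
    t : ℕ → ℤ
    t j = e (suc (2 ℕ.* u)) (suc j) * (w ^ j * numerator w (u ∸ j))

    term : ∀ (i : Fin (suc u)) →
           fromℤ (e (2 ℕ.* suc u ∸ 1) (suc (toℕ i))) ℚ.* lookup (history r u) i ≡ r ^ℚ u ℚ.* fromℤ (t (toℕ i))
    term i = begin
      fromℤ (e (2 ℕ.* suc u ∸ 1) (suc j)) ℚ.* lookup (history r u) i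
        ≡⟨ cong₂ (λ s x → fromℤ (e s (suc j)) ℚ.* x) (odd-index u) (trans (lookup-history r u i) (IH j)) ⟩
      fromℤ eⱼ ℚ.* (r ^ℚ (u ∸ j) ℚ.* fromℤ b)
        -- Rewriting r^(u-j) as r^u w^j gives all terms the common factor r^u; the remaining w^j is
        -- the power in the recursion of `numerator`.
        ≡⟨ cong (λ x → fromℤ eⱼ ℚ.* (x ℚ.* fromℤ b)) (^ℚ-∸ rw≡1 (toℕ≤pred[n] i)) ⟩
      fromℤ eⱼ ℚ.* (r ^ℚ u ℚ.* fromℤ (w ^ j) ℚ.* fromℤ b)
        ≡⟨ cong (fromℤ eⱼ ℚ.*_) (ℚ.*-assoc (r ^ℚ u) _ _) ⟩
      fromℤ eⱼ ℚ.* (r ^ℚ u ℚ.* (fromℤ (w ^ j) ℚ.* fromℤ b))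
        ≡⟨ x∙yz≈y∙xz (fromℤ eⱼ) (r ^ℚ u) _ ⟩
      r ^ℚ u ℚ.* (fromℤ eⱼ ℚ.* (fromℤ (w ^ j) ℚ.* fromℤ b))
        ≡⟨ cong (λ x → r ^ℚ u ℚ.* (fromℤ eⱼ ℚ.* x)) (fromℤ-* (w ^ j) b) ⟨
      r ^ℚ u ℚ.* (fromℤ eⱼ ℚ.* fromℤ (w ^ j * b))
        ≡⟨ cong (r ^ℚ u ℚ.*_) (fromℤ-* eⱼ (w ^ j * b)) ⟨
      r ^ℚ u ℚ.* fromℤ (t j) ∎
      where
      j = toℕ i
      eⱼ = e (suc (2 ℕ.* u)) (suc j)
      b = numerator w (u ∸ j)

-- Coprimality and congruences with rational numbers.

coprime-∣-cancel : ∀ {n} a {b} → Coprime n ∣ a ∣ → + n ∣ a * b → + n ∣ b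
coprime-∣-cancel {n} a {b} n⊥a n∣ab = ∣ᵤ⇒∣ (ℤ.coprime-divisor (+ n) a b n⊥a (∣⇒∣ᵤ n∣ab))

coprime-*⁻ˡ : ∀ {n} a b → Coprime n ∣ a * b ∣ → Coprime n ∣ a ∣
coprime-*⁻ˡ a b n⊥ab (d∣n , d∣a) = n⊥ab (d∣n , subst (_ ℕ.∣_) (sym (abs-* a b)) (ℕ.∣m⇒∣m*n ∣ b ∣ d∣a))

coprime-*⁻ʳ : ∀ {n} a b → Coprime n ∣ a * b ∣ → Coprime n ∣ b ∣
coprime-*⁻ʳ a b n⊥ab (d∣n , d∣b) = n⊥ab (d∣n , subst (_ ℕ.∣_) (sym (abs-* a b)) (ℕ.∣n⇒∣m*n ∣ a ∣ d∣b))

coprime-^ : ∀ {n} w → Coprime n ∣ w ∣ → ∀ v → Coprime n ∣ w ^ v ∣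
coprime-^ w n⊥w zero    (d∣n , d∣1) = ℕ.∣1⇒≡1 d∣1
coprime-^ w n⊥w (suc v) {d} (d∣n , d∣wʷ) = coprime-^ w n⊥w v
  (d∣n , Coprime.coprime-divisor (λ { (c∣d , c∣w) → n⊥w (ℕ.∣-trans c∣d d∣n , c∣w) }) (subst (d ℕ.∣_) (abs-* w (w ^ v)) d∣wʷ))

-- B / W need not be in lowest terms. If q = a / d is, then d divides B d = a W and is prime to a,
-- so d divides W and is prime to n. Finally W (a - d x) = d (B - W x), and W can be cancelled
-- modulo n.
rational-congruence : ∀ {n} q W B x → Coprime n ∣ W ∣ → q ℚ.* fromℤ W ≡ fromℤ B → + n ∣ B - W * x →
                      x ≡ q [mod n ]
rational-congruence {n} q@(mkℚ a d-1 a⊥d) W B x n⊥W qW≡B n∣B-Wx =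
  d⊥n , ∣⇒∣ᵤ (coprime-∣-cancel W n⊥W (subst (+ n ∣_) (sym rearranged) (∣n⇒∣m*n (↧ q) n∣B-Wx)))
  where
  cross : a * W ≡ B * ↧ q
  cross with ℚᵘ.≃-trans (ℚᵘ.≃-sym (ℚ.toℚᵘ-homo-* q (fromℤ W))) (ℚᵘ.≃-reflexive (cong ℚ.toℚᵘ qW≡B))
  ... | *≡* eq = trans (sym (*-identityʳ (a * W))) (trans eq (cong (λ m → B * + m) (ℕ.*-identityʳ (suc d-1))))

  d∣W : ↧ₙ q ℕ.∣ ∣ W ∣
  d∣W = Coprime.coprime-divisor (Coprime.sym (Coprime.recompute a⊥d))
    (subst (↧ₙ q ℕ.∣_) (trans (sym (abs-* B (↧ q))) (trans (cong ∣_∣ (sym cross)) (abs-* a W))) (ℕ.n∣m*n ∣ B ∣))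

  d⊥n : Coprime (↧ₙ q) n
  d⊥n (c∣d , c∣n) = n⊥W (c∣n , ℕ.∣-trans c∣d d∣W)

  rearranged : W * (a - ↧ q * x) ≡ ↧ q * (B - W * x)
  rearranged = linear-combination 1ℤ cross (lemma W a (↧ q) B x)
    where
    lemma : ∀ W a d B x → W * (a - d * x) ≡ d * (B - W * x) + 1ℤ * (a * W - B * d)
    lemma = solve-∀

-- Congruences between the moments S_v.

sum-∣ : ∀ n {d f} → (∀ k → k < n → d ∣ f k) → d ∣ sum n f
sum-∣ zero    d∣f = divides 0ℤ refl
sum-∣ (suc n) d∣f = ∣m∣n⇒∣m+n (d∣f 0 (s≤s z≤n)) (sum-∣ n (λ k k<n → d∣f (suc k) (s≤s k<n)))

moment : (ℕ → ℤ) → ℕ → ℕ → ℤ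
moment E n v = sum n (λ k → (+ (2 ℕ.* k ℕ.+ 1)) ^ (2 ℕ.* v) * E k)

-- The telescoped sum is a multiple of n + 1. Its double is four times the claimed difference:
-- doubling turns the coefficients k + 1 and k into x + 1 and x - 1 with x = 2k+1, after which
-- `binomial-e` applies. As the modulus is odd, 2 is cancelled twice.
moment-recurrence : ∀ w E → E 1 ≡ (+ 2 * w + 1ℤ) * E 0 → DelannoyRecurrence (+ 2 * w + 1ℤ) E → ∀ n u →
  Coprime (suc n) 2 →
  + suc n ∣ sum (suc u) (λ j → e (suc (2 ℕ.* u)) (suc j) * moment E (suc n) (u ∸ j)) - w * moment E (suc n) (suc u)
moment-recurrence w E E₁ rec n u n⊥2 = coprime-∣-cancel (+ 2) n⊥2 (coprime-∣-cancel (+ 2) n⊥2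
  (subst (+ suc n ∣_) (sym identity) (∣n⇒∣m*n (+ 2) (∣m⇒∣m*n (p (2 ℕ.+ n) * E n - p (1 ℕ.+ n) * E (1 ℕ.+ n)) ∣-refl))))
  where
  m = + 2 * w + 1ℤ
  s = suc (2 ℕ.* u)
  N = suc n
  p g x : ℕ → ℤ
  -- The weight (2k+1)^s shifted by one index, so that `p (1 ℕ.+ k)` belongs to k; in the sum of
  -- `g`, the value `p 0` meets the coefficient 0.
  p k = (+ 2 * + k - 1ℤ) ^ s
  g k = E k * ((1ℤ + + k) * p (2 ℕ.+ k) + + k * p k - m * (1ℤ + + 2 * + k) * p (1 ℕ.+ k))
  x k = + (2 ℕ.* k ℕ.+ 1)
  row col : ℕ → ℕ → ℤ
  row k j = e s (suc j) * x k ^ (2 ℕ.* (u ∸ j))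
  col k j = e s (suc j) * (x k ^ (2 ℕ.* (u ∸ j)) * E k)
  top : ℕ → ℤ
  top k = x k ^ (2 ℕ.* suc u) * E k

  x≡ : ∀ k → x k ≡ + 2 * + k + 1ℤ
  x≡ k = cong (_+ 1ℤ) (pos-* 2 k)

  sum-col : ∀ k → sum (suc u) (row k) * E k ≡ sum (suc u) (col k)
  sum-col k = trans (sum-*ʳ (suc u) (row k) (E k))
    (sum-cong (suc u) (λ j → *-assoc (e s (suc j)) (x k ^ (2 ℕ.* (u ∸ j))) (E k)))

  term : ∀ k → + 2 * g k ≡ + 4 * sum (suc u) (col k) + - (+ 4 * w) * top k
  term k = begin
    + 2 * g k
      ≡⟨ double w (+ k) (E k) (p (2 ℕ.+ k)) (p k) (p (1 ℕ.+ k)) ⟩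
    E k * ((X + 1ℤ) * p (2 ℕ.+ k) + (X - 1ℤ) * p k - + 2 * (m * (X * p (1 ℕ.+ k))))
      ≡⟨ cong₂ (λ a b → E k * (a - + 2 * (m * b))) neighbours centre ⟩
    E k * (+ 2 * x k ^ (2 ℕ.* suc u) + + 4 * sum (suc u) (row k) - + 2 * (m * x k ^ (2 ℕ.* suc u)))
      -- The leading term 2 x^(2u+2) cancels against the summand 1 of m = 2w+1, which leaves -4w.
      ≡⟨ collect w (E k) (x k ^ (2 ℕ.* suc u)) (sum (suc u) (row k)) ⟩
    + 4 * (sum (suc u) (row k) * E k) + - (+ 4 * w) * top k
      ≡⟨ cong (λ t → + 4 * t + - (+ 4 * w) * top k) (sum-col k) ⟩
    + 4 * sum (suc u) (col k) + - (+ 4 * w) * top k ∎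
    where
    X = + 2 * + k + 1ℤ

    double : ∀ w k e a b c →
      + 2 * (e * ((1ℤ + k) * a + k * b - (+ 2 * w + 1ℤ) * (1ℤ + + 2 * k) * c)) ≡
      e * ((+ 2 * k + 1ℤ + 1ℤ) * a + (+ 2 * k + 1ℤ - 1ℤ) * b - + 2 * ((+ 2 * w + 1ℤ) * ((+ 2 * k + 1ℤ) * c)))
    double = solve-∀

    next : ∀ k → + 2 * (+ 2 + k) - 1ℤ ≡ + 2 * k + 1ℤ + + 2
    next = solve-∀
    previous : ∀ k → + 2 * k - 1ℤ ≡ + 2 * k + 1ℤ - + 2
    previous = solve-∀
    current : ∀ k → + 2 * (1ℤ + k) - 1ℤ ≡ + 2 * k + 1ℤ
    current = solve-∀

    neighbours : (X + 1ℤ) * p (2 ℕ.+ k) + (X - 1ℤ) * p k ≡ + 2 * x k ^ (2 ℕ.* suc u) + + 4 * sum (suc u) (row k)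
    neighbours = begin
      (X + 1ℤ) * p (2 ℕ.+ k) + (X - 1ℤ) * p k
        ≡⟨ cong₂ (λ a b → (X + 1ℤ) * a ^ s + (X - 1ℤ) * b ^ s) (next (+ k)) (previous (+ k)) ⟩
      (X + 1ℤ) * (X + + 2) ^ s + (X - 1ℤ) * (X - + 2) ^ s
        ≡⟨ cong (λ X → (X + 1ℤ) * (X + + 2) ^ s + (X - 1ℤ) * (X - + 2) ^ s) (x≡ k) ⟨
      (x k + 1ℤ) * (x k + + 2) ^ s + (x k - 1ℤ) * (x k - + 2) ^ s
        ≡⟨ binomial-e (x k) u ⟩
      + 2 * x k ^ (2 ℕ.* suc u) + + 4 * sum (suc u) (row k) ∎

    centre : X * p (1 ℕ.+ k) ≡ x k ^ (2 ℕ.* suc u)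
    centre = begin
      X * p (1 ℕ.+ k)        ≡⟨ cong (λ a → X * a ^ s) (current (+ k)) ⟩
      X ^ suc s              ≡⟨ cong₂ _^_ (sym (x≡ k)) (sym (ℕ.*-suc 2 u)) ⟩
      x k ^ (2 ℕ.* suc u)    ∎

    collect : ∀ w e t r → e * (+ 2 * t + + 4 * r - + 2 * ((+ 2 * w + 1ℤ) * t)) ≡ + 4 * (r * e) + - (+ 4 * w) * (t * e)
    collect = solve-∀

  sum-cols : sum N (λ k → sum (suc u) (col k)) ≡ sum (suc u) (λ j → e s (suc j) * moment E N (u ∸ j))
  sum-cols = trans (sum-comm N (suc u) col)
    (sum-cong (suc u) (λ j → sym (sum-*ˡ N (e s (suc j)) (λ k → x k ^ (2 ℕ.* (u ∸ j)) * E k))))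

  identity : + 2 * (+ 2 * (sum (suc u) (λ j → e s (suc j) * moment E N (u ∸ j)) - w * moment E N (suc u))) ≡
             + 2 * ((1ℤ + + n) * (p (2 ℕ.+ n) * E n - p (1 ℕ.+ n) * E (1 ℕ.+ n)))
  identity = begin
    + 2 * (+ 2 * (sum (suc u) (λ j → e s (suc j) * moment E N (u ∸ j)) - w * moment E N (suc u)))
      ≡⟨ cong (λ t → + 2 * (+ 2 * (t - w * moment E N (suc u)))) sum-cols ⟨
    + 2 * (+ 2 * (sum N (λ k → sum (suc u) (col k)) - w * sum N top))
      ≡⟨ expand w (sum N (λ k → sum (suc u) (col k))) (sum N top) ⟩
    + 4 * sum N (λ k → sum (suc u) (col k)) + - (+ 4 * w) * sum N top
      ≡⟨ sum-linear N (+ 4) (- (+ 4 * w)) (λ k → sum (suc u) (col k)) top ⟩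
    sum N (λ k → + 4 * sum (suc u) (col k) + - (+ 4 * w) * top k)
      ≡⟨ sum-cong N term ⟨
    sum N (λ k → + 2 * g k)
      ≡⟨ sum-*ˡ N (+ 2) g ⟨
    + 2 * sum N g
      ≡⟨ cong (+ 2 *_) (telescope m E p E₁ rec n) ⟩
    + 2 * ((1ℤ + + n) * (p (2 ℕ.+ n) * E n - p (1 ℕ.+ n) * E (1 ℕ.+ n))) ∎
    where
    expand : ∀ w a b → + 2 * (+ 2 * (a - w * b)) ≡ + 4 * a + - (+ 4 * w) * b
    expand = solve-∀

-- Multiplying the relation for M (u+1) by w^u and splitting w^u = w^j w^(u-j) in the j-th term
-- makes the induction hypothesis applicable to w^(u-j) M (u-j); the result is the recursion of
-- `numerator` times M 0.
numerator-congruence : ∀ {n} w (M : ℕ → ℤ) →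
  (∀ u → + n ∣ sum (suc u) (λ j → e (suc (2 ℕ.* u)) (suc j) * M (u ∸ j)) - w * M (suc u)) →
  ∀ v → + n ∣ numerator w v * M 0 - w ^ v * M v
numerator-congruence {n} w M rec = course-of-values _ (subst (+ n ∣_) (sym (+-inverseʳ (1ℤ * M 0))) (divides 0ℤ refl)) step
  where
  step : ∀ u → (∀ j → + n ∣ numerator w (u ∸ j) * M 0 - w ^ (u ∸ j) * M (u ∸ j)) →
         + n ∣ numerator w (suc u) * M 0 - w ^ suc u * M (suc u)
  step u IH = subst (+ n ∣_) (sym identity) (∣m∣n⇒∣m+n
    (sum-∣ (suc u) (λ j _ → ∣n⇒∣m*n (eᵤ j) (∣n⇒∣m*n (w ^ j) (IH j))))
    (∣n⇒∣m*n (w ^ u) (rec u)))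
    where
    eᵤ : ℕ → ℤ
    eᵤ j = e (suc (2 ℕ.* u)) (suc j)
    δ : ℕ → ℤ
    δ j = eᵤ j * (w ^ j * (numerator w (u ∸ j) * M 0 - w ^ (u ∸ j) * M (u ∸ j)))
    ν : ℕ → ℤ
    ν j = eᵤ j * (w ^ j * numerator w (u ∸ j))
    μ : ℕ → ℤ
    μ j = eᵤ j * M (u ∸ j)

    split : ∀ j → j < suc u → δ j ≡ M 0 * ν j + - (w ^ u) * μ j
    split j (s≤s j≤u) = begin
      δ j
        ≡⟨ lemma (eᵤ j) (w ^ j) (numerator w (u ∸ j)) (M 0) (w ^ (u ∸ j)) (M (u ∸ j)) ⟩
      M 0 * ν j + - (w ^ j * w ^ (u ∸ j)) * μ j
        ≡⟨ cong (λ t → M 0 * ν j + - t * μ j) (trans (sym (^-distribˡ-+-* w j (u ∸ j))) (cong (w ^_) (ℕ.m+[n∸m]≡n j≤u))) ⟩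
      M 0 * ν j + - (w ^ u) * μ j ∎
      where
      lemma : ∀ e x b m y k → e * (x * (b * m - y * k)) ≡ m * (e * (x * b)) + - (x * y) * (e * k)
      lemma = solve-∀

    identity : numerator w (suc u) * M 0 - w ^ suc u * M (suc u) ≡
               sum (suc u) δ + w ^ u * (sum (suc u) μ - w * M (suc u))
    identity = begin
      numerator w (suc u) * M 0 - w ^ suc u * M (suc u)
        ≡⟨ cong (λ t → t * M 0 - w ^ suc u * M (suc u)) (numerator-suc w u) ⟩
      sum (suc u) ν * M 0 - w ^ suc u * M (suc u)
        ≡⟨ lemma (sum (suc u) ν) (sum (suc u) μ) (M 0) (w ^ u) w (M (suc u)) ⟩
      M 0 * sum (suc u) ν + - (w ^ u) * sum (suc u) μ + w ^ u * (sum (suc u) μ - w * M (suc u))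
        ≡⟨ cong (_+ w ^ u * (sum (suc u) μ - w * M (suc u)))
             (trans (sum-linear (suc u) (M 0) (- (w ^ u)) ν μ) (sym (sum-cong-< (suc u) split))) ⟩
      sum (suc u) δ + w ^ u * (sum (suc u) μ - w * M (suc u)) ∎
      where
      lemma : ∀ a b m y w k → a * m - w * y * k ≡ m * a + - y * b + y * (b - w * k)
      lemma = solve-∀

-- The plain and the alternating sums.

D₁≡[2z+1]D₀ : ∀ z → D 1 z ≡ (+ 2 * z + 1ℤ) * D 0 z
D₁≡[2z+1]D₀ = lemma
  where
  lemma : ∀ z → 1ℤ + (+ 2 * (z * 1ℤ) + 0ℤ) ≡ (+ 2 * z + 1ℤ) * 1ℤ
  lemma = solve-∀

signedD : ℤ → ℕ → ℤ
signedD z k = -1ℤ ^ k * D k z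

signedD₁≡[2w+1]signedD₀ : ∀ z → signedD z 1 ≡ (+ 2 * - (z + 1ℤ) + 1ℤ) * signedD z 0
signedD₁≡[2w+1]signedD₀ z = linear-combination -1ℤ (D₁≡[2z+1]D₀ z) (lemma z (D 0 z) (D 1 z))
  where
  lemma : ∀ z d₀ d₁ → -1ℤ * 1ℤ * d₁ ≡
    (+ 2 * - (z + 1ℤ) + 1ℤ) * (1ℤ * d₀) + -1ℤ * (d₁ - (+ 2 * z + 1ℤ) * d₀)
  lemma = solve-∀

-- Multiplying by (-1)^n flips only the middle term relative to the outer two, so 2z+1 becomes
-- -(2z+1) = 2w+1 with w = -(z+1).
signedD-recurrence : ∀ z → DelannoyRecurrence (+ 2 * - (z + 1ℤ) + 1ℤ) (signedD z)
signedD-recurrence z n = linear-combination (-1ℤ ^ n) (D-recurrence z n)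
  (lemma z (+ n) (-1ℤ ^ n) (D n z) (D (1 ℕ.+ n) z) (D (2 ℕ.+ n) z))
  where
  lemma : ∀ z n ε d₀ d₁ d₂ →
    (+ 2 + n) * (-1ℤ * (-1ℤ * ε) * d₂) + (1ℤ + n) * (ε * d₀) ≡
    (+ 2 * - (z + 1ℤ) + 1ℤ) * ((+ 3 + + 2 * n) * (-1ℤ * ε * d₁))
      + ε * ((+ 2 + n) * d₂ + (1ℤ + n) * d₀ - (+ 2 * z + 1ℤ) * ((+ 3 + + 2 * n) * d₁))
  lemma = solve-∀

recSeq-congruence : ∀ {r w} → r ℚ.* fromℤ w ≡ 1ℚ → ∀ E → E 1 ≡ (+ 2 * w + 1ℤ) * E 0 →
  DelannoyRecurrence (+ 2 * w + 1ℤ) E → ∀ n .{{_ : ℕ.NonZero n}} → Coprime n 2 → Coprime n ∣ w ∣ → ∀ v →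
  moment E n v ≡ recSeq r v ℚ.* fromℤ (moment E n 0) [mod n ]
recSeq-congruence {r} {w} rw≡1 E E₁ rec n@(suc n-1) n⊥2 n⊥w v =
  -- The fraction c_v S_0 is presented with denominator w^v, which is prime to n but need not be
  -- reduced.
  rational-congruence (recSeq r v ℚ.* fromℤ S) (w ^ v) (numerator w v * S) (moment E n v) (coprime-^ w n⊥w v) cleared
    (numerator-congruence w (moment E n) (λ u → moment-recurrence w E E₁ rec n-1 u n⊥2) v)
  where
  S = moment E n 0

  cleared : recSeq r v ℚ.* fromℤ S ℚ.* fromℤ (w ^ v) ≡ fromℤ (numerator w v * S)
  cleared = begin
    recSeq r v ℚ.* fromℤ S ℚ.* fromℤ (w ^ v)
      ≡⟨ cong (λ x → x ℚ.* fromℤ S ℚ.* fromℤ (w ^ v)) (recSeq≡numerator rw≡1 v) ⟩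
    r ^ℚ v ℚ.* fromℤ (numerator w v) ℚ.* fromℤ S ℚ.* fromℤ (w ^ v)
      ≡⟨ cong (ℚ._* fromℤ (w ^ v)) (ℚ.*-assoc (r ^ℚ v) (fromℤ (numerator w v)) (fromℤ S)) ⟩
    r ^ℚ v ℚ.* (fromℤ (numerator w v) ℚ.* fromℤ S) ℚ.* fromℤ (w ^ v)
      ≡⟨ cong (λ x → r ^ℚ v ℚ.* x ℚ.* fromℤ (w ^ v)) (fromℤ-* (numerator w v) S) ⟨
    r ^ℚ v ℚ.* fromℤ (numerator w v * S) ℚ.* fromℤ (w ^ v)
      ≡⟨ xy∙z≈xz∙y (r ^ℚ v) (fromℤ (numerator w v * S)) (fromℤ (w ^ v)) ⟩
    r ^ℚ v ℚ.* fromℤ (w ^ v) ℚ.* fromℤ (numerator w v * S)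
      ≡⟨ cong (ℚ._* fromℤ (numerator w v * S)) (^ℚ-∸ rw≡1 (ℕ.≤-refl {v})) ⟨
    r ^ℚ (v ∸ v) ℚ.* fromℤ (numerator w v * S)
      ≡⟨ cong (λ k → r ^ℚ k ℚ.* fromℤ (numerator w v * S)) (ℕ.n∸n≡0 v) ⟩
    1ℚ ℚ.* fromℤ (numerator w v * S)
      ≡⟨ ℚ.*-identityˡ _ ⟩
    fromℤ (numerator w v * S) ∎

recip-inverseˡ : ∀ i .{{_ : NonZero i}} → recip i ℚ.* fromℤ i ≡ 1ℚ
recip-inverseˡ i = ℚ.*-inverseˡ (fromℤ i)

neg-recip-inverseˡ : ∀ i .{{_ : NonZero i}} → ℚ.- recip i ℚ.* fromℤ (- i) ≡ 1ℚ
neg-recip-inverseˡ i = begin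
  ℚ.- recip i ℚ.* fromℤ (- i)    ≡⟨ cong (ℚ.- recip i ℚ.*_) (fromℤ-neg i) ⟩
  ℚ.- recip i ℚ.* ℚ.- fromℤ i    ≡⟨ ℚ.neg-distribˡ-* (recip i) (ℚ.- fromℤ i) ⟨
  ℚ.- (recip i ℚ.* ℚ.- fromℤ i)  ≡⟨ cong ℚ.-_ (ℚ.neg-distribʳ-* (recip i) (fromℤ i)) ⟨
  ℚ.- (ℚ.- (recip i ℚ.* fromℤ i)) ≡⟨ cong (λ x → ℚ.- (ℚ.- x)) (recip-inverseˡ i) ⟩
  1ℚ ∎

neg-^ℚ : ∀ r v → (ℚ.- r) ^ℚ v ≡ r ^ℚ v ℚ.* fromℤ (-1ℤ ^ v)
neg-^ℚ r zero    = refl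
neg-^ℚ r (suc v) = begin
  ℚ.- r ℚ.* (ℚ.- r) ^ℚ v                                ≡⟨ cong₂ ℚ._*_ neg (neg-^ℚ r v) ⟩
  r ℚ.* fromℤ -1ℤ ℚ.* (r ^ℚ v ℚ.* fromℤ (-1ℤ ^ v))      ≡⟨ *-interchange r (fromℤ -1ℤ) (r ^ℚ v) (fromℤ (-1ℤ ^ v)) ⟩
  r ^ℚ suc v ℚ.* (fromℤ -1ℤ ℚ.* fromℤ (-1ℤ ^ v))        ≡⟨ cong (r ^ℚ suc v ℚ.*_) (fromℤ-* -1ℤ (-1ℤ ^ v)) ⟨
  r ^ℚ suc v ℚ.* fromℤ (-1ℤ ^ suc v)                    ∎
  where
  neg : ℚ.- r ≡ r ℚ.* fromℤ -1ℤ
  neg = trans (cong ℚ.-_ (sym (ℚ.*-identityʳ r))) (ℚ.neg-distribʳ-* r 1ℚ)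

∑≡moment : ∀ {f E : ℕ → ℤ} n v → (∀ k → f k ≡ (+ (2 ℕ.* k ℕ.+ 1)) ^ (2 ℕ.* v) * E k) → ∑ n f ≡ moment E n v
∑≡moment {f} n v f≡ = trans (∑≡sum n f) (sum-cong n f≡)

-- Polynomial witnesses and the theorem.

c-polynomial : ∀ v → ∃[ P ] (∀ (z : ℤ) .{{_ : NonZero z}} .{{_ : NonZero (z + 1ℤ)}} →
               c v z ≡ recip z ^ℚ v ℚ.* fromℤ (eval P z))
c-polynomial v = let P , p = numerator-polynomial id-polynomial v in
  P , λ z → trans (recSeq≡numerator (recip-inverseˡ z) v) (cong (λ x → recip z ^ℚ v ℚ.* fromℤ x) (sym (p z)))

c̃-polynomial : ∀ v → ∃[ P ] (∀ (z : ℤ) .{{_ : NonZero z}} .{{_ : NonZero (z + 1ℤ)}} →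
               c̃ v z ≡ recip (z + 1ℤ) ^ℚ v ℚ.* fromℤ (eval P z))
-- Here r is 1/(z+1), whereas the recursion uses -r; the sign (-1)^v from (-r)^v is absorbed into
-- the witness.
c̃-polynomial v = let P , p = *-polynomial (const-polynomial (-1ℤ ^ v)) (numerator-polynomial -[z+1]-polynomial v) in
  P , λ z → let r = recip (z + 1ℤ); b = numerator (-1ℤ * (z + 1ℤ)) v in begin
    recSeq (ℚ.- r) v
      ≡⟨ recSeq≡numerator (neg-recip-inverseˡ (z + 1ℤ)) v ⟩
    (ℚ.- r) ^ℚ v ℚ.* fromℤ (numerator (- (z + 1ℤ)) v)
      ≡⟨ cong₂ (λ x w → x ℚ.* fromℤ (numerator w v)) (neg-^ℚ r v) (sym (-1*i≡-i (z + 1ℤ))) ⟩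
    r ^ℚ v ℚ.* fromℤ (-1ℤ ^ v) ℚ.* fromℤ b
      ≡⟨ ℚ.*-assoc (r ^ℚ v) (fromℤ (-1ℤ ^ v)) (fromℤ b) ⟩
    r ^ℚ v ℚ.* (fromℤ (-1ℤ ^ v) ℚ.* fromℤ b)
      ≡⟨ cong (r ^ℚ v ℚ.*_) (fromℤ-* (-1ℤ ^ v) b) ⟨
    r ^ℚ v ℚ.* fromℤ (-1ℤ ^ v * b)
      ≡⟨ cong (λ x → r ^ℚ v ℚ.* fromℤ x) (p z) ⟨
    r ^ℚ v ℚ.* fromℤ (eval P z) ∎
  where
  -[z+1]-polynomial : IsPolynomial (λ z → -1ℤ * (z + 1ℤ))
  -[z+1]-polynomial = *-polynomial (const-polynomial -1ℤ) (+-polynomial id-polynomial (const-polynomial 1ℤ))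

gcd≡1⇒coprime : ∀ n i → gcd (+ n) i ≡ 1ℤ → Coprime n ∣ i ∣
gcd≡1⇒coprime n i eq = Coprime.gcd≡1⇒coprime (+-injective eq)

theorem1p1 : (v : ℕ) →
    (∃[ P ] (∀ (z : ℤ) .{{_ : NonZero z}} .{{_ : NonZero (z + 1ℤ)}} →
    c v z ≡ recip z ^ℚ v ℚ.* fromℤ (eval P z)))
    ×
    (∃[ P ] (∀ (z : ℤ) .{{_ : NonZero z}} .{{_ : NonZero (z + 1ℤ)}} →
    c̃ v z ≡ recip (z + 1ℤ) ^ℚ v ℚ.* fromℤ (eval P z)))
    ×
    (∀ (n : ℕ) .{{_ : ℕ.NonZero n}} (z : ℤ) .{{_ : NonZero z}} .{{_ : NonZero (z + 1ℤ)}} →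
    (gcd (+ n) (+ 2 * z) ≡ 1ℤ →
    (∑[ k < n ] ((+ (2 ℕ.* k ℕ.+ 1)) ^ (2 ℕ.* v) * D k z))
    ≡ c v z ℚ.* fromℤ (∑[ k < n ] (D k z)) [mod n ])
    ×
    (gcd (+ n) (+ 2 * (z + 1ℤ)) ≡ 1ℤ →
    (∑[ k < n ] (-1ℤ ^ k * (+ (2 ℕ.* k ℕ.+ 1)) ^ (2 ℕ.* v) * D k z))
    ≡ c̃ v z ℚ.* fromℤ (∑[ k < n ] (-1ℤ ^ k * D k z)) [mod n ]))
theorem1p1 v = c-polynomial v , c̃-polynomial v , λ n z →
  (λ gcd≡1 → let n⊥2z = gcd≡1⇒coprime n (+ 2 * z) gcd≡1 in
    subst₂ (λ x y → x ≡ c v z ℚ.* fromℤ y [mod n ])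
      (sym (∑≡moment n v (λ k → refl)))
      -- The unweighted sum is the moment with v = 0, whose weight reduces to 1.
      (sym (∑≡moment n 0 (λ k → sym (*-identityˡ (D k z)))))
      (recSeq-congruence {w = z} (recip-inverseˡ z) (λ k → D k z) (D₁≡[2z+1]D₀ z) (D-recurrence z) n
        (coprime-*⁻ˡ (+ 2) z n⊥2z) (coprime-*⁻ʳ (+ 2) z n⊥2z) v)) ,
  (λ gcd≡1 → let n⊥2[z+1] = gcd≡1⇒coprime n (+ 2 * (z + 1ℤ)) gcd≡1 in
    subst₂ (λ x y → x ≡ c̃ v z ℚ.* fromℤ y [mod n ])
      (sym (∑≡moment {E = signedD z} n v (λ k → swap (-1ℤ ^ k) ((+ (2 ℕ.* k ℕ.+ 1)) ^ (2 ℕ.* v)) (D k z))))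
      (sym (∑≡moment n 0 (λ k → sym (*-identityˡ (signedD z k)))))
      (recSeq-congruence {w = - (z + 1ℤ)} (neg-recip-inverseˡ (z + 1ℤ)) (signedD z) (signedD₁≡[2w+1]signedD₀ z)
        (signedD-recurrence z) n
        (coprime-*⁻ˡ (+ 2) (z + 1ℤ) n⊥2[z+1])
        (subst (Coprime n) (sym (∣-i∣≡∣i∣ (z + 1ℤ))) (coprime-*⁻ʳ (+ 2) (z + 1ℤ) n⊥2[z+1])) v))
  where
  swap : ∀ ε x d → ε * x * d ≡ x * (ε * d)
  swap = solve-∀
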